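{- Let $A=(a_{i,j})_{1\le i,j\le 3}$ be a $3\times 3$ matrix. Then for all integers $m\ge 1$, $$\left(a_{1,2} a_{2,1} a_{2,3}-a_{1,3} a_{2,1} a_{2,2}+a_{1,3} a_{2,1} a_{3,3}-a_{1,3} a_{2,3} a_{3,1}\right) \cdot (A^m)_{12}$$ $$+\left(a_{1,2} a_{2,3} a_{3,1}-a_{1,3} a_{2,1} a_{3,2}\right) \cdot (A^m)_{13}$$ $$+\left(-a_{1,2}^{2} a_{2,3}+a_{1,2} a_{1,3} a_{2,2}-a_{1,2} a_{1,3} a_{3,3}+a_{1,3}^{2} a_{3,2}\right) \cdot (A^m)_{21} = 0 .$$
   Context: For a matrix $B$, $B_{ij}$ denotes its $(i,j)$ entry. The entries of $A$ are commuting quantities (e.g. elements of a field or indeterminates). -}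

module Defs where

open import Algebra.Bundles using (CommutativeRing)
open import Data.Bool.Base using (if_then_else_)
open import Data.Fin.Base using (Fin)
open import Data.Fin.Properties using (_≟_)
open import Data.Nat.Base using (ℕ; zero; suc)
open import Relation.Nullary.Decidable.Core using (does)

module Matrices {c ℓ} (R : CommutativeRing c ℓ) where

  open CommutativeRing R
  open import Algebra.Properties.Semiring.Sum semiring using (sum-syntax)
  open import Algebra.Properties.Semiring.Exp semiring public using (_^_)

  SquareMatrix : ℕ → Set c
  SquareMatrix n = Fin n → Fin n → Carrier

  identityᴹ : ∀ {n} → SquareMatrix n
  identityᴹ i j = if does (i ≟ j) then 1# else 0#

  infixl 7 _*ᴹ_
  _*ᴹ_ : ∀ {n} → SquareMatrix n → SquareMatrix n → SquareMatrix n
  _*ᴹ_ {n} A B i j = ∑[ k < n ] (A i k * B k j)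

  infixr 8 _^ᴹ_
  _^ᴹ_ : ∀ {n} → SquareMatrix n → ℕ → SquareMatrix n
  A ^ᴹ zero  = identityᴹ
  A ^ᴹ suc m = A *ᴹ (A ^ᴹ m)

{-# OPTIONS --safe #-}

-- Every power B of A commutes with A, and the linear form in the theorem vanishes on
-- every matrix B commuting with A.  Indeed, writing cᵢⱼ for the (i,j) entry of AB − BA,
-- the form equals
--   − a₁₂a₂₃ c₁₁ + a₁₂a₁₃ c₂₁ + a₁₃a₂₁ c₁₂ + a₁₃ (a₃₁ c₁₃ + a₁₃ c₃₁ + (a₁₁ − a₃₃) c₁₁).
module Submission where

open import Defs
open import Algebra.Bundles using (CommutativeRing)
import Algebra.Properties.AbelianGroup as AbelianGroupProperties
import Algebra.Properties.Semiring.Sum as SemiringSum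
import Algebra.Solver.Ring.NaturalCoefficients.Default as NaturalCoefficients
open import Data.Fin.Base using (Fin; zero; suc)
open import Data.Fin.Patterns using (0F; 1F; 2F)
open import Data.Nat.Base using (ℕ; zero; suc; _≥_)
import Relation.Binary.Reasoning.Setoid as SetoidReasoning
open import Relation.Binary.PropositionalEquality.Core as ≡ using (_≡_)

module MatrixProperties {c ℓ} (R : CommutativeRing c ℓ) where

  open CommutativeRing R hiding (zero)
  open Matrices R
  open SemiringSum semiring
  open SetoidReasoning setoid

  infix 4 _≈ᴹ_
  _≈ᴹ_ : ∀ {n} → SquareMatrix n → SquareMatrix n → Set ℓ
  A ≈ᴹ B = ∀ i j → A i j ≈ B i j

  *ᴹ-congˡ : ∀ {n} (A : SquareMatrix n) {B C} → B ≈ᴹ C → A *ᴹ B ≈ᴹ A *ᴹ C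
  *ᴹ-congˡ A B≈C i j = sum-cong-≋ λ k → *-congˡ (B≈C k j)

  *ᴹ-assoc : ∀ {n} (A B C : SquareMatrix n) → (A *ᴹ B) *ᴹ C ≈ᴹ A *ᴹ (B *ᴹ C)
  *ᴹ-assoc {n} A B C i j = begin
    ∑[ k < n ] (∑[ l < n ] (A i l * B l k) * C k j)
      ≈⟨ sum-cong-≋ (λ k → *-distribʳ-sum (C k j) (λ l → A i l * B l k)) ⟩
    ∑[ k < n ] ∑[ l < n ] (A i l * B l k * C k j)
      ≈⟨ ∑-comm (λ k l → A i l * B l k * C k j) ⟩
    ∑[ l < n ] ∑[ k < n ] (A i l * B l k * C k j)
      ≈⟨ sum-cong-≋ (λ l → sum-cong-≋ λ k → *-assoc (A i l) (B l k) (C k j)) ⟩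
    ∑[ l < n ] ∑[ k < n ] (A i l * (B l k * C k j))
      ≈⟨ sum-cong-≋ (λ l → *-distribˡ-sum (A i l) (λ k → B l k * C k j)) ⟨
    ∑[ l < n ] (A i l * ∑[ k < n ] (B l k * C k j))
      ∎

  identityᴹ-sym : ∀ {n} (i j : Fin n) → identityᴹ i j ≡ identityᴹ j i
  identityᴹ-sym zero    zero    = ≡.refl
  identityᴹ-sym zero    (suc j) = ≡.refl
  identityᴹ-sym (suc i) zero    = ≡.refl
  -- The test `does (suc i ≟ suc j)` reduces to `does (i ≟ j)`, so dropping both successors leaves
  -- the entry unchanged definitionally.
  identityᴹ-sym (suc i) (suc j) = identityᴹ-sym i j

  -- An arbitrary `f` serves both unit laws: it is a column of `A` for the left one and, by symmetry
  -- of the identity matrix, a row of `A` for the right one.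
  ∑-identityᴹ : ∀ {n} (i : Fin n) (f : Fin n → Carrier) →
                ∑[ k < n ] (identityᴹ i k * f k) ≈ f i
  ∑-identityᴹ {suc n} zero f = begin
    1# * f zero + ∑[ k < n ] (0# * f (suc k))
      -- Pulling the factor `0#` out turns the whole tail into one product by zero.
      ≈⟨ +-cong (*-identityˡ _) (sym (*-distribˡ-sum 0# (λ k → f (suc k)))) ⟩
    f zero + 0# * ∑[ k < n ] f (suc k)  ≈⟨ +-congˡ (zeroˡ _) ⟩
    f zero + 0#                         ≈⟨ +-identityʳ _ ⟩
    f zero                              ∎
  ∑-identityᴹ {suc n} (suc i) f = begin
    0# * f zero + ∑[ k < n ] (identityᴹ i k * f (suc k))
      ≈⟨ +-cong (zeroˡ _) (∑-identityᴹ i (λ k → f (suc k))) ⟩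
    0# + f (suc i)  ≈⟨ +-identityˡ _ ⟩
    f (suc i)       ∎

  *ᴹ-identityˡ : ∀ {n} (A : SquareMatrix n) → identityᴹ *ᴹ A ≈ᴹ A
  *ᴹ-identityˡ A i j = ∑-identityᴹ i (λ k → A k j)

  *ᴹ-identityʳ : ∀ {n} (A : SquareMatrix n) → A *ᴹ identityᴹ ≈ᴹ A
  *ᴹ-identityʳ {n} A i j = begin
    ∑[ k < n ] (A i k * identityᴹ k j)
      ≈⟨ sum-cong-≋ (λ k → trans (*-comm _ _) (*-congʳ (reflexive (identityᴹ-sym k j)))) ⟩
    ∑[ k < n ] (identityᴹ j k * A i k)  ≈⟨ ∑-identityᴹ j (A i) ⟩
    A i j                               ∎

  -- Induction on `m`: A(A A^m) = A(A^m A) = (A A^m)A, by the induction hypothesis under the left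
  -- factor `A`, then associativity.
  ^ᴹ-comm : ∀ {n} (A : SquareMatrix n) m → A *ᴹ A ^ᴹ m ≈ᴹ A ^ᴹ m *ᴹ A
  ^ᴹ-comm A zero    i j = trans (*ᴹ-identityʳ A i j) (sym (*ᴹ-identityˡ A i j))
  ^ᴹ-comm A (suc m) i j =
    trans (*ᴹ-congˡ A (^ᴹ-comm A m) i j) (sym (*ᴹ-assoc A (A ^ᴹ m) A i j))

module CentralizerRelation {c ℓ} (R : CommutativeRing c ℓ) (A : Matrices.SquareMatrix R 3) where

  open CommutativeRing R
  open Matrices R
  open MatrixProperties R using (_≈ᴹ_)
  open NaturalCoefficients commutativeSemiring
    using (Polynomial; con; _:+_; _:*_; _:^_; _:=_; solve)
  open AbelianGroupProperties +-abelianGroup using (∙-cancelʳ)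

  private
    a₁₁ = A 0F 0F
    a₁₂ = A 0F 1F
    a₁₃ = A 0F 2F
    a₂₁ = A 1F 0F
    a₂₂ = A 1F 1F
    a₂₃ = A 1F 2F
    a₃₁ = A 2F 0F
    a₃₂ = A 2F 1F
    a₃₃ = A 2F 2F

  -- The combination of commutators in the header is combine (B *ᴹ A) (A *ᴹ B) minus
  -- combine (A *ᴹ B) (B *ᴹ A).
  combine : SquareMatrix 3 → SquareMatrix 3 → Carrier
  combine X Y =
      a₁₂ * a₂₃ * X 0F 0F + a₁₂ * a₁₃ * Y 1F 0F + a₁₃ * a₂₁ * Y 0F 1F
    + a₁₃ * (a₃₁ * Y 0F 2F + a₁₃ * Y 2F 0F + a₁₁ * Y 0F 0F + a₃₃ * X 0F 0F)

  combine-cong : ∀ {X X′ Y Y′} → X ≈ᴹ X′ → Y ≈ᴹ Y′ → combine X Y ≈ combine X′ Y′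
  combine-cong X≈ Y≈ =
    +-cong (+-cong (+-cong (*-congˡ (X≈ 0F 0F)) (*-congˡ (Y≈ 1F 0F))) (*-congˡ (Y≈ 0F 1F)))
      (*-congˡ (+-cong (+-cong (+-cong
        (*-congˡ (Y≈ 0F 2F)) (*-congˡ (Y≈ 2F 0F))) (*-congˡ (Y≈ 0F 0F))) (*-congˡ (X≈ 0F 0F))))

  -- The n's stand for the negated monomials of the linear form, which makes this an
  -- identity of commutative semirings: the solver's natural coefficients cannot see
  -- cancellation in an abstract ring.
  combine-swap : ∀ (B : SquareMatrix 3) n₁ n₂ n₃ n₄ n₅ →
    let b₁₂ = B 0F 1F
        b₁₃ = B 0F 2F
        b₂₁ = B 1F 0F
    in
      (a₁₂ * a₂₁ * a₂₃ + n₁ + a₁₃ * a₂₁ * a₃₃ + n₂) * b₁₂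
      + (a₁₂ * a₂₃ * a₃₁ + n₃) * b₁₃
      + (n₄ + a₁₂ * a₁₃ * a₂₂ + n₅ + a₁₃ ^ 2 * a₃₂) * b₂₁
      + combine (A *ᴹ B) (B *ᴹ A)
    ≈ ((a₁₃ * a₂₁ * a₂₂ + n₁) + (a₁₃ * a₂₃ * a₃₁ + n₂)) * b₁₂
      + (a₁₃ * a₂₁ * a₃₂ + n₃) * b₁₃
      + ((a₁₂ ^ 2 * a₂₃ + n₄) + (a₁₂ * a₁₃ * a₃₃ + n₅)) * b₂₁
      + combine (B *ᴹ A) (A *ᴹ B)
  combine-swap B =
    solve 23
      (λ a₁₁ a₁₂ a₁₃ a₂₁ a₂₂ a₂₃ a₃₁ a₃₂ a₃₃ b₁₁ b₁₂ b₁₃ b₂₁ b₂₂ b₂₃ b₃₁ b₃₂ b₃₃ n₁ n₂ n₃ n₄ n₅ →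
        let dot : (u v w x y z : Polynomial 23) → Polynomial 23
            -- The right nesting and the final `con 0` copy how a sum over `Fin 3` unfolds, so the
            -- solved equation matches the entries of `A *ᴹ B` and `B *ᴹ A` definitionally.
            dot u v w x y z = u :* x :+ (v :* y :+ (w :* z :+ con 0))
            ab₁₁ = dot a₁₁ a₁₂ a₁₃ b₁₁ b₂₁ b₃₁
            ab₁₂ = dot a₁₁ a₁₂ a₁₃ b₁₂ b₂₂ b₃₂
            ab₁₃ = dot a₁₁ a₁₂ a₁₃ b₁₃ b₂₃ b₃₃
            ab₂₁ = dot a₂₁ a₂₂ a₂₃ b₁₁ b₂₁ b₃₁
            ab₃₁ = dot a₃₁ a₃₂ a₃₃ b₁₁ b₂₁ b₃₁
            ba₁₁ = dot b₁₁ b₁₂ b₁₃ a₁₁ a₂₁ a₃₁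
            ba₁₂ = dot b₁₁ b₁₂ b₁₃ a₁₂ a₂₂ a₃₂
            ba₁₃ = dot b₁₁ b₁₂ b₁₃ a₁₃ a₂₃ a₃₃
            ba₂₁ = dot b₂₁ b₂₂ b₂₃ a₁₁ a₂₁ a₃₁
            ba₃₁ = dot b₃₁ b₃₂ b₃₃ a₁₁ a₂₁ a₃₁
            comb : (x₁₁ y₁₁ y₁₂ y₁₃ y₂₁ y₃₁ : Polynomial 23) → Polynomial 23
            comb x₁₁ y₁₁ y₁₂ y₁₃ y₂₁ y₃₁ =
              a₁₂ :* a₂₃ :* x₁₁ :+ a₁₂ :* a₁₃ :* y₂₁ :+ a₁₃ :* a₂₁ :* y₁₂
              :+ a₁₃ :* (a₃₁ :* y₁₃ :+ a₁₃ :* y₃₁ :+ a₁₁ :* y₁₁ :+ a₃₃ :* x₁₁)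
        in
          (a₁₂ :* a₂₁ :* a₂₃ :+ n₁ :+ a₁₃ :* a₂₁ :* a₃₃ :+ n₂) :* b₁₂
          :+ (a₁₂ :* a₂₃ :* a₃₁ :+ n₃) :* b₁₃
          :+ (n₄ :+ a₁₂ :* a₁₃ :* a₂₂ :+ n₅ :+ a₁₃ :^ 2 :* a₃₂) :* b₂₁
          :+ comb ab₁₁ ba₁₁ ba₁₂ ba₁₃ ba₂₁ ba₃₁
        := ((a₁₃ :* a₂₁ :* a₂₂ :+ n₁) :+ (a₁₃ :* a₂₃ :* a₃₁ :+ n₂)) :* b₁₂
          :+ (a₁₃ :* a₂₁ :* a₃₂ :+ n₃) :* b₁₃
          :+ ((a₁₂ :^ 2 :* a₂₃ :+ n₄) :+ (a₁₂ :* a₁₃ :* a₃₃ :+ n₅)) :* b₂₁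
          :+ comb ba₁₁ ab₁₁ ab₁₂ ab₁₃ ab₂₁ ab₃₁)
      refl
      a₁₁ a₁₂ a₁₃ a₂₁ a₂₂ a₂₃ a₃₁ a₃₂ a₃₃
      (B 0F 0F) (B 0F 1F) (B 0F 2F) (B 1F 0F) (B 1F 1F) (B 1F 2F) (B 2F 0F) (B 2F 1F) (B 2F 2F)

  -- Since `A` and `B` commute, the two `combine` terms of `combine-swap` are equal and can be
  -- cancelled. What remains on the right is zero once each `n` is the negative of the monomial it
  -- is paired with.
  vanishes-on-centralizer : ∀ (B : SquareMatrix 3) → A *ᴹ B ≈ᴹ B *ᴹ A →
      (a₁₂ * a₂₁ * a₂₃ - a₁₃ * a₂₁ * a₂₂ + a₁₃ * a₂₁ * a₃₃ - a₁₃ * a₂₃ * a₃₁) * B 0F 1F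
      + (a₁₂ * a₂₃ * a₃₁ - a₁₃ * a₂₁ * a₃₂) * B 0F 2F
      + (- (a₁₂ ^ 2 * a₂₃) + a₁₂ * a₁₃ * a₂₂ - a₁₂ * a₁₃ * a₃₃ + a₁₃ ^ 2 * a₃₂) * B 1F 0F
      ≈ 0#
  vanishes-on-centralizer B AB≈BA = ∙-cancelʳ (combine (A *ᴹ B) (B *ᴹ A)) _ _
    -- The five blanks are found by unification with the goal, where `x - y` unfolds to `x + - y`:
    -- they are the negated monomials of the form, in order of appearance.
    (trans (combine-swap B _ _ _ _ _)
      (+-cong
        -- Each `-‿inverseʳ` kills one pair `x + - x`: two pairs in the coefficient of `B 0F 1F`,
        -- one in that of `B 0F 2F`, two in that of `B 1F 0F`.
        (sum-zero (sum-zero (zero-* (sum-zero (-‿inverseʳ _) (-‿inverseʳ _)))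
                            (zero-* (-‿inverseʳ _)))
                  (zero-* (sum-zero (-‿inverseʳ _) (-‿inverseʳ _))))
        (combine-cong (λ i j → sym (AB≈BA i j)) AB≈BA)))
    where
    zero-* : ∀ {x y} → x ≈ 0# → x * y ≈ 0#
    zero-* x≈0 = trans (*-congʳ x≈0) (zeroˡ _)

    sum-zero : ∀ {x y} → x ≈ 0# → y ≈ 0# → x + y ≈ 0#
    sum-zero x≈0 y≈0 = trans (+-cong x≈0 y≈0) (+-identityˡ 0#)

mainTheorem3 : ∀ {c ℓ} (R : CommutativeRing c ℓ) →
  let open CommutativeRing R
      open Matrices R
  in
  (A : SquareMatrix 3) (m : ℕ) → m ≥ 1 →
  let a₁₂ = A 0F 1F
      a₁₃ = A 0F 2F
      a₂₁ = A 1F 0F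
      a₂₂ = A 1F 1F
      a₂₃ = A 1F 2F
      a₃₁ = A 2F 0F
      a₃₂ = A 2F 1F
      a₃₃ = A 2F 2F
  in
    (a₁₂ * a₂₁ * a₂₃ - a₁₃ * a₂₁ * a₂₂ + a₁₃ * a₂₁ * a₃₃ - a₁₃ * a₂₃ * a₃₁) * (A ^ᴹ m) 0F 1F
    + (a₁₂ * a₂₃ * a₃₁ - a₁₃ * a₂₁ * a₃₂) * (A ^ᴹ m) 0F 2F
    + (- (a₁₂ ^ 2 * a₂₃) + a₁₂ * a₁₃ * a₂₂ - a₁₂ * a₁₃ * a₃₃ + a₁₃ ^ 2 * a₃₂) * (A ^ᴹ m) 1F 0F
    ≈ 0#
mainTheorem3 R A m _ =
  CentralizerRelation.vanishes-on-centralizer R A (A ^ᴹ m) (MatrixProperties.^ᴹ-comm R A m)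
  where open Matrices R
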